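{- Let $p,q,r,s\in\{0,1\}$ and let $n\ge1$. The resolution calculus for the logic of confluence $\mathsf{K}_{(n)}^{p,q,r,s}$ terminates: for every finite set $\mathcal{T}$ of clauses, every derivation from $\mathcal{T}$ in which each step adds a clause not already present is finite, so that after finitely many steps either a contradiction has been derived or no new clauses can be derived by further application of the rules of the calculus.
   Context: **Syntax.** Let $\mathcal{A}_n=\{1,\dots,n\}$ be a finite set of agents and $\mathcal{P}$ a denumerable set of propositional symbols. Formulae are built from $\mathcal{P}$, $\mathbf{true}$, a nullary connective $\mathbf{start}$, $\neg$, $\wedge$ and unary modal operators $\Box_a$ ($a\in\mathcal{A}_n$), with the usual abbreviations $\mathbf{false},\vee,\Rightarrow$ and $\Diamond_a=\neg\Box_a\neg$. A literal is a propositional symbol or its negation; for a literal $l$, $\neg l$ denotes its complement (so $\neg\neg p$ is $p$). $\Box^*$ denotes the universal operator ($\Box^*\varphi$ says that $\varphi$ holds at the current world and at all worlds reachable from it). **Logics.** $\mathsf{K}_{(n)}^{p,q,r,s}$ is the normal multimodal logic $\mathsf{K}_{(n)}$ plus the axioms $\mathbf{G}_a^{p,q,r,s}:\ \Diamond_a^p\Box_a^q\varphi\Rightarrow\Box_a^r\Diamond_a^s\varphi$ for all $a\in\mathcal{A}_n$. **Clauses.** A clause is $\Box^*A$ where $A$ has one of the forms: initial clause $\mathbf{start}\Rightarrow\bigvee_b l_b$; literal clause $\mathbf{true}\Rightarrow\bigvee_b l_b$; positive $a$-clause $l'\Rightarrow\Box_a l$; negative $a$-clause $l'\Rightarrow\neg\Box_a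 l$ (with $l,l',l_b$ literals, finite disjunctions, the empty disjunction being $\mathbf{false}$). Below $\Box^*$ is suppressed. Clauses are simplified by standard classical simplification (e.g. $D\vee l\vee l$ becomes $D\vee l$), and are considered modulo this simplification. **Definition clauses.** Let $\mathcal{L}(\mathcal{T})$ be the set of literals $x,\neg x$ with $x$ a propositional symbol occurring in $\mathcal{T}$. For each $l\in\mathcal{L}(\mathcal{T})$ and each agent $a$ occurring in $\mathcal{T}$, $pos_{a,l}$ is a new propositional symbol (definition symbol), with definition clauses $pos_{a,l}\Rightarrow\neg\Box_a\neg l$ and $\neg pos_{a,l}\Rightarrow\Box_a\neg l$. These are the only definition symbols used: a rule is not applied if its conclusion would contain another one, in particular a nested symbol such as $pos_{a,pos_{a,l}}$. **Rules for $\mathsf{K}_{(n)}$** ($D,D'$ disjunctions of literals, all other letters literals, premises separated by semicolons, conclusion after $\vdash$): - IRES1: $\mathbf{true}\Rightarrow D\vee l;\ \mathbf{start}\Rightarrow D'\vee\neg l\ \vdash\ \mathbf{start}\Rightarrow D\vee D'$. - IRES2: $\mathbf{start}\Rightarrow D\vee l;\ \mathbf{start}\Rightarrow D'\vee\neg l\ \vdash\ \mathbf{start}\Rightarrow D\vee D'$. - LRES: $\mathbf{true}\Rightarrow D\vee l;\ \mathbf{true}\Rightarrow D'\vee\neg l\ \vdash\ \mathbf{true}\Rightarrow D\vee D'$. - MRES: $l_1\Rightarrow\Box_a l;\ l_2\Rightarrow\neg\Box_a l\ \vdash\ \mathbf{true}\Rightarrow\neg l_1\vee\neg l_2$. - NEC1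 ($m\ge0$): $l_1'\Rightarrow\Box_a\neg l_1;\dots;l_m'\Rightarrow\Box_a\neg l_m;\ l'\Rightarrow\neg\Box_a l;\ \mathbf{true}\Rightarrow l_1\vee\dots\vee l_m\vee l\ \vdash\ \mathbf{true}\Rightarrow\neg l_1'\vee\dots\vee\neg l_m'\vee\neg l'$. - NEC2: $l_1'\Rightarrow\Box_a l_1;\ l_2'\Rightarrow\Box_a\neg l_1;\ l_3'\Rightarrow\neg\Box_a l_2\ \vdash\ \mathbf{true}\Rightarrow\neg l_1'\vee\neg l_2'\vee\neg l_3'$. - NEC3 ($m\ge1$): $l_1'\Rightarrow\Box_a\neg l_1;\dots;l_m'\Rightarrow\Box_a\neg l_m;\ l'\Rightarrow\neg\Box_a l;\ \mathbf{true}\Rightarrow l_1\vee\dots\vee l_m\ \vdash\ \mathbf{true}\Rightarrow\neg l_1'\vee\dots\vee\neg l_m'\vee\neg l'$. **Additional rules for $\mathsf{K}_{(n)}^{p,q,r,s}$**, depending on $(p,q,r,s)$ (the tuples $(p,q,r,s)$ and $(r,s,p,q)$ define the same logic and share their rules): - $(0,0,0,1)$ or $(0,1,0,0)$ [T]: $\mathbf{true}\Rightarrow D\vee l\ \vdash\ \neg D\Rightarrow\neg\Box_a\neg l$; and $l\Rightarrow\Box_a l'\ \vdash\ \mathbf{true}\Rightarrow\neg l\vee l'$. - $(0,0,1,0)$ or $(1,0,0,0)$ [Ban]: $\mathbf{true}\Rightarrow D\vee l\ \vdash\ \neg D\Rightarrow\Box_a l$; and $l\Rightarrow\neg\Box_a\neg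 l'\ \vdash\ \mathbf{true}\Rightarrow\neg l\vee l'$. - $(0,0,1,1)$ or $(1,1,0,0)$ [B]: $\mathbf{true}\Rightarrow D\vee l\ \vdash\ \neg D\Rightarrow\Box_a pos_{a,l}$; and $l\Rightarrow\Box_a l'\ \vdash\ \neg l'\Rightarrow\Box_a\neg l$. - $(0,1,0,1)$ [D]: $l\Rightarrow\Box_a l'\ \vdash\ l\Rightarrow\neg\Box_a\neg l'$. - $(0,1,1,1)$ or $(1,1,0,1)$: $l\Rightarrow\Box_a l'\ \vdash\ l\Rightarrow\Box_a pos_{a,l'}$; and $l\Rightarrow\Box_a l'\ \vdash\ pos_{a,l}\Rightarrow\neg\Box_a\neg l'$. - $(1,0,1,0)$ [F]: $l\Rightarrow\neg\Box_a\neg l'\ \vdash\ l\Rightarrow\Box_a l'$. - $(1,0,1,1)$ or $(1,1,1,0)$ [5]: $l\Rightarrow\neg\Box_a\neg l'\ \vdash\ l\Rightarrow\Box_a pos_{a,l'}$; and $l\Rightarrow\Box_a l'\ \vdash\ pos_{a,l}\Rightarrow\Box_a l'$. - $(1,1,1,1)$ [G1]: $l\Rightarrow\Box_a l'\ \vdash\ pos_{a,l}\Rightarrow\Box_a pos_{a,l'}$. - $(0,0,0,0),(0,1,1,0),(1,0,0,1)$ (the axiom is a tautology): no additional rules. **Derivations.** A derivation from $\mathcal{T}$ is a sequence $\mathcal{T}_0,\mathcal{T}_1,\dots$ where $\mathcal{T}_0$ is $\mathcal{T}$ together with the definition clauses, and $\mathcal{T}_i$ results from adding to $\mathcal{T}_{i-1}$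 the conclusion of an application of a rule for $\mathsf{K}_{(n)}$ or an additional rule for $\mathsf{K}_{(n)}^{p,q,r,s}$ to clauses in $\mathcal{T}_{i-1}$. A contradiction is a clause $\Box^*(\mathbf{start}\Rightarrow\mathbf{false})$ or $\Box^*(\mathbf{true}\Rightarrow\mathbf{false})$. A derivation terminates iff either a contradiction is derived or no new clauses can be derived by further application of the rules. -}

module Defs where

open import Data.Fin using (Fin)
open import Data.Fin.Patterns using (0F; 1F)
open import Data.List using (List; []; _∷_; [_]; _++_; map; concatMap; length)
open import Data.List.Membership.Propositional using (_∈_)
open import Data.List.Relation.Unary.All using (All)
open import Data.List.Relation.Unary.Any using (Any)
open import Data.List.Relation.Binary.BagAndSetEquality using (_∼[_]_; set)
open import Data.Maybe using (Maybe; just; nothing)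
open import Data.Nat using (ℕ; suc; _≤_)
open import Data.Product using (_×_; _,_; proj₁; proj₂; ∃; ∃₂)
open import Data.Sum using (_⊎_)
open import Function using (_∘_; id)
open import Relation.Binary.PropositionalEquality using (_≡_)
open import Relation.Nullary using (¬_)

infix 8 ~_
infix 4 _⇒□[_]_ _⇒¬□[_]_ _≈_ _∈ᶜ_ _∉ᶜ_

data Literal (S : Set) : Set where
  pl nl : S → Literal S

~_ : {S : Set} → Literal S → Literal S
~ pl x = nl x
~ nl x = pl x

symbolOf : {S : Set} → Literal S → S
symbolOf (pl x) = x
symbolOf (nl x) = x

mapLiteral : {S S′ : Set} → (S → S′) → Literal S → Literal S′
mapLiteral f (pl x) = pl (f x)
mapLiteral f (nl x) = nl (f x)

-- Nested symbols pos a (pl (pos b l)) exist here, as in the object language;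
-- it is the applicability condition `Admissible` below that keeps them out
-- of derivations.
data Symbol (P : Set) (n : ℕ) : Set where
  prop : P → Symbol P n
  pos  : Fin n → Literal (Symbol P n) → Symbol P n

-- Clauses, with the prefix □* suppressed.  A list of literals on the right
-- is a disjunction, [] being false.  L is the type of left-hand sides of
-- modal clauses.
data ClauseOver (L S : Set) (n : ℕ) : Set where
  start⇒_   : List (Literal S) → ClauseOver L S n
  true⇒_    : List (Literal S) → ClauseOver L S n
  _⇒□[_]_   : L → Fin n → Literal S → ClauseOver L S n
  _⇒¬□[_]_  : L → Fin n → Literal S → ClauseOver L S n

Clause : Set → ℕ → Set
Clause S n = ClauseOver (Literal S) S n

-- The rules with conclusion ¬D ⇒ □ₐ l or ¬D ⇒ ¬□ₐ l, for D a disjunction,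
-- produce a conjunction of literals on the left.  Such conclusions are
-- recorded with a list of literals, read conjunctively, [] being true.  A
-- clause l′ ⇒ □ₐ l is the case of a one-element list, and only this case can
-- be a premise of a rule.
Clause∧ : Set → ℕ → Set
Clause∧ S n = ClauseOver (List (Literal S)) S n

literals : {L S : Set} {n : ℕ} → (L → List (Literal S)) →
           ClauseOver L S n → List (Literal S)
literals left (start⇒ D)        = D
literals left (true⇒ D)         = D
literals left (l′ ⇒□[ a ] l)    = left l′ ++ [ l ]
literals left (l′ ⇒¬□[ a ] l)   = left l′ ++ [ l ]

agentsOf : {L S : Set} {n : ℕ} → ClauseOver L S n → List (Fin n)
agentsOf (start⇒ D)       = []
agentsOf (true⇒ D)        = []
agentsOf (l′ ⇒□[ a ] l)   = [ a ]
agentsOf (l′ ⇒¬□[ a ] l)  = [ a ]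

-- Equality modulo simplification: disjunctions and conjunctions are compared
-- as sets of literals.
data _≈_ {S : Set} {n : ℕ} : Clause∧ S n → Clause∧ S n → Set where
  start⇒_  : ∀ {D D′} → D ∼[ set ] D′ → (start⇒ D) ≈ (start⇒ D′)
  true⇒_   : ∀ {D D′} → D ∼[ set ] D′ → (true⇒ D) ≈ (true⇒ D′)
  pos-≈    : ∀ {C C′ a l} → C ∼[ set ] C′ → (C ⇒□[ a ] l) ≈ (C′ ⇒□[ a ] l)
  neg-≈    : ∀ {C C′ a l} → C ∼[ set ] C′ → (C ⇒¬□[ a ] l) ≈ (C′ ⇒¬□[ a ] l)

ClauseSet : Set → ℕ → Set
ClauseSet S n = List (Clause∧ S n)

_∈ᶜ_ _∉ᶜ_ : {S : Set} {n : ℕ} → Clause∧ S n → ClauseSet S n → Set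
c ∈ᶜ U = Any (c ≈_) U
c ∉ᶜ U = ¬ (c ∈ᶜ U)

module _ {P : Set} {n : ℕ} where

  private
    Lit : Set
    Lit = Literal (Symbol P n)

    Cl : Set
    Cl = Clause∧ (Symbol P n) n

  data KRule : List Cl → Cl → Set where

    IRES1 : ∀ D D′ l →
      KRule ((true⇒ (D ++ [ l ])) ∷ (start⇒ (D′ ++ [ ~ l ])) ∷ [])
            (start⇒ (D ++ D′))

    IRES2 : ∀ D D′ l →
      KRule ((start⇒ (D ++ [ l ])) ∷ (start⇒ (D′ ++ [ ~ l ])) ∷ [])
            (start⇒ (D ++ D′))

    LRES : ∀ D D′ l →
      KRule ((true⇒ (D ++ [ l ])) ∷ (true⇒ (D′ ++ [ ~ l ])) ∷ [])
            (true⇒ (D ++ D′))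

    MRES : ∀ a l l₁ l₂ →
      KRule (([ l₁ ] ⇒□[ a ] l) ∷ ([ l₂ ] ⇒¬□[ a ] l) ∷ [])
            (true⇒ (~ l₁ ∷ ~ l₂ ∷ []))

    -- In NEC1 and NEC3, ps lists the pairs (l′ᵢ , lᵢ).
    NEC1 : ∀ a (ps : List (Lit × Lit)) l′ l →
      KRule (map (λ (l′ᵢ , lᵢ) → [ l′ᵢ ] ⇒□[ a ] ~ lᵢ) ps
               ++ ([ l′ ] ⇒¬□[ a ] l)
               ∷ (true⇒ (map proj₂ ps ++ [ l ])) ∷ [])
            (true⇒ (map (~_ ∘ proj₁) ps ++ [ ~ l′ ]))

    NEC2 : ∀ a l₁ l₂ l′₁ l′₂ l′₃ →
      KRule (([ l′₁ ] ⇒□[ a ] l₁) ∷ ([ l′₂ ] ⇒□[ a ] ~ l₁)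
               ∷ ([ l′₃ ] ⇒¬□[ a ] l₂) ∷ [])
            (true⇒ (~ l′₁ ∷ ~ l′₂ ∷ ~ l′₃ ∷ []))

    NEC3 : ∀ a (ps : List (Lit × Lit)) l′ l → 1 ≤ length ps →
      KRule (map (λ (l′ᵢ , lᵢ) → [ l′ᵢ ] ⇒□[ a ] ~ lᵢ) ps
               ++ ([ l′ ] ⇒¬□[ a ] l)
               ∷ (true⇒ map proj₂ ps) ∷ [])
            (true⇒ (map (~_ ∘ proj₁) ps ++ [ ~ l′ ]))

  -- One representative of each pair of tuples (p,q,r,s), (r,s,p,q)
  data GRule₁ : (p q r s : Fin 2) → List Cl → Cl → Set where

    T₁ : ∀ a D l →
      GRule₁ 0F 0F 0F 1F ((true⇒ (D ++ [ l ])) ∷ []) (map ~_ D ⇒¬□[ a ] ~ l)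
    T₂ : ∀ a l l′ →
      GRule₁ 0F 0F 0F 1F (([ l ] ⇒□[ a ] l′) ∷ []) (true⇒ (~ l ∷ l′ ∷ []))

    Ban₁ : ∀ a D l →
      GRule₁ 0F 0F 1F 0F ((true⇒ (D ++ [ l ])) ∷ []) (map ~_ D ⇒□[ a ] l)
    Ban₂ : ∀ a l l′ →
      GRule₁ 0F 0F 1F 0F (([ l ] ⇒¬□[ a ] ~ l′) ∷ []) (true⇒ (~ l ∷ l′ ∷ []))

    B₁ : ∀ a D l →
      GRule₁ 0F 0F 1F 1F ((true⇒ (D ++ [ l ])) ∷ [])
                         (map ~_ D ⇒□[ a ] pl (pos a l))
    B₂ : ∀ a l l′ →
      GRule₁ 0F 0F 1F 1F (([ l ] ⇒□[ a ] l′) ∷ []) ([ ~ l′ ] ⇒□[ a ] ~ l)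

    D₁ : ∀ a l l′ →
      GRule₁ 0F 1F 0F 1F (([ l ] ⇒□[ a ] l′) ∷ []) ([ l ] ⇒¬□[ a ] ~ l′)

    0111₁ : ∀ a l l′ →
      GRule₁ 0F 1F 1F 1F (([ l ] ⇒□[ a ] l′) ∷ [])
                         ([ l ] ⇒□[ a ] pl (pos a l′))
    0111₂ : ∀ a l l′ →
      GRule₁ 0F 1F 1F 1F (([ l ] ⇒□[ a ] l′) ∷ [])
                         ([ pl (pos a l) ] ⇒¬□[ a ] ~ l′)

    F₁ : ∀ a l l′ →
      GRule₁ 1F 0F 1F 0F (([ l ] ⇒¬□[ a ] ~ l′) ∷ []) ([ l ] ⇒□[ a ] l′)

    5₁ : ∀ a l l′ →
      GRule₁ 1F 0F 1F 1F (([ l ] ⇒¬□[ a ] ~ l′) ∷ [])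
                         ([ l ] ⇒□[ a ] pl (pos a l′))
    5₂ : ∀ a l l′ →
      GRule₁ 1F 0F 1F 1F (([ l ] ⇒□[ a ] l′) ∷ [])
                         ([ pl (pos a l) ] ⇒□[ a ] l′)

    G1₁ : ∀ a l l′ →
      GRule₁ 1F 1F 1F 1F (([ l ] ⇒□[ a ] l′) ∷ [])
                         ([ pl (pos a l) ] ⇒□[ a ] pl (pos a l′))

  GRule : (p q r s : Fin 2) → List Cl → Cl → Set
  GRule p q r s Γ c = GRule₁ p q r s Γ c ⊎ GRule₁ r s p q Γ c

  Rule : (p q r s : Fin 2) → List Cl → Cl → Set
  Rule p q r s Γ c = KRule Γ c ⊎ GRule p q r s Γ c

  -- The given clauses are built from P only, so the symbols pos a l are new.
  module _ (T : List (Clause P n)) where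

    agents : List (Fin n)
    agents = concatMap agentsOf T

    -- ℒ(T)
    ℒ : List (Literal P)
    ℒ = concatMap (λ x → pl x ∷ nl x ∷ [])
                  (concatMap (map symbolOf ∘ literals [_]) T)

    forDefinitions : {A : Set} → (Fin n → Lit → List A) → List A
    forDefinitions f =
      concatMap (λ a → concatMap (λ l → f a (mapLiteral prop l)) ℒ) agents

    definitionSymbols : List (Symbol P n)
    definitionSymbols = forDefinitions λ a l → [ pos a l ]

    definitionClauses : ClauseSet (Symbol P n) n
    definitionClauses = forDefinitions λ a l →
      ([ pl (pos a l) ] ⇒¬□[ a ] ~ l) ∷ ([ nl (pos a l) ] ⇒□[ a ] ~ l) ∷ []

    Admissible : Cl → Set
    Admissible c = ∀ a l → pos a l ∈ map symbolOf (literals id c) →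
                   pos a l ∈ definitionSymbols

  embed : Clause P n → Cl
  embed (start⇒ D)        = start⇒ map (mapLiteral prop) D
  embed (true⇒ D)         = true⇒ map (mapLiteral prop) D
  embed (l′ ⇒□[ a ] l)    = [ mapLiteral prop l′ ] ⇒□[ a ] mapLiteral prop l
  embed (l′ ⇒¬□[ a ] l)   = [ mapLiteral prop l′ ] ⇒¬□[ a ] mapLiteral prop l

  initialSet : List (Clause P n) → ClauseSet (Symbol P n) n
  initialSet T = map embed T ++ definitionClauses T

  module Calculus (p q r s : Fin 2) (T : List (Clause P n)) where

    data Derivable (U : ClauseSet (Symbol P n) n) : Cl → Set where
      apply : ∀ {Γ c} → Rule p q r s Γ c → All (_∈ᶜ U) Γ → Admissible T c →
              Derivable U c

    data Step (U : ClauseSet (Symbol P n) n) :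
              ClauseSet (Symbol P n) n → Set where
      add : ∀ {c} → Derivable U c → c ∉ᶜ U → Step U (c ∷ U)

    HasContradiction : ClauseSet (Symbol P n) n → Set
    HasContradiction U = ((start⇒ []) ∈ᶜ U) ⊎ ((true⇒ []) ∈ᶜ U)

    Saturated : ClauseSet (Symbol P n) n → Set
    Saturated U = ∀ c → Derivable U c → c ∈ᶜ U

    Terminated : ClauseSet (Symbol P n) n → Set
    Terminated U = HasContradiction U ⊎ Saturated U

    data Next : Maybe (ClauseSet (Symbol P n) n) →
                Maybe (ClauseSet (Symbol P n) n) → Set where
      step    : ∀ {U V} → Step U V → Next (just U) (just V)
      stop    : ∀ {U} → Next (just U) nothing
      stopped : Next nothing nothing

    -- Finite or infinite sequences 𝒯₀, 𝒯₁, … in which each step adds a new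
    -- clause; stage i is nothing beyond the end of a finite one.
    record Derivation : Set where
      field
        stage : ℕ → Maybe (ClauseSet (Symbol P n) n)
        first : stage 0 ≡ just (initialSet T)
        next  : ∀ i → Next (stage i) (stage (suc i))

    open Derivation public

    Finite : Derivation → Set
    Finite d = ∃ λ k → stage d k ≡ nothing

    Exhaustive : Derivation → Set
    Exhaustive d = ∀ k U → stage d k ≡ just U → stage d (suc k) ≡ nothing →
                   Terminated U

    Terminates : Derivation → Set
    Terminates d = ∃₂ λ k U → stage d k ≡ just U × Terminated U

{-# OPTIONS --safe #-}

-- Resolution introduces no proposition symbols and admissibility confines the
-- symbols pos a l to the finitely many definition symbols, so every derivable
-- clause is over a finite set of literals.  Modulo ≈ the parameters of the rules
-- (disjunctions, and the lists of pairs of NEC1 and NEC3) can be taken to be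
-- sublists of fixed lists.  Hence finitely many rule instances represent all of
-- them: each step uses up one of their conclusions, and trying them all decides
-- whether a new clause is derivable.
module Submission where

open import Defs
open import Data.Nat using (ℕ; _≥_)
open import Data.Fin using (Fin)
open import Data.List using (List)
open import Data.Product using (∃; _×_)
open import Function.Bundles using (_↔_)
open import Relation.Binary.Construct.Closure.ReflexiveTransitive using (Star)

open import Data.Fin.Patterns using (0F; 1F)
import Data.Fin.Properties as Fin
open import Data.List
  using ([]; _∷_; [_]; _++_; map; concatMap; filter; length; allFin; cartesianProduct)
open import Data.List.Membership.Propositional using (_∈_; find; lose)
open import Data.List.Membership.Propositional.Properties
  using (∈-allFin; ∈-cartesianProduct⁺; ∈-concatMap⁺; ∈-concatMap⁻;
         ∈-filter⁺; ∈-filter⁻; ∈-map⁺; ∈-map⁻; ∈-++⁺ˡ; ∈-++⁺ʳ)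
import Data.List.Membership.DecPropositional as DecMembership
open import Data.List.Properties using (filter-notAll)
open import Data.List.Relation.Binary.BagAndSetEquality
  using (_∼[_]_; set; [_]-Equality; ∷-cong; ++-cong; map-cong)
open import Data.List.Relation.Binary.Subset.DecPropositional using (_⊆?_)
open import Data.List.Relation.Unary.All as All using (All; []; _∷_)
import Data.List.Relation.Unary.All.Properties as All
open import Data.List.Relation.Unary.Any as Any using (Any; here; there)
import Data.List.Relation.Unary.Any.Properties as Any
open import Data.Maybe using (just; nothing)
open import Data.Nat as ℕ using (suc; _<_; z≤n; s≤s)
open import Data.Nat.Induction using (<-wellFounded)
open import Data.Product using (_,_; proj₁; proj₂; uncurry; ∃₂)
open import Data.Product.Properties using (≡-dec)
open import Data.Sum using (inj₁; inj₂; _⊎_)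
open import Data.Unit using (⊤; tt)
open import Function using (_∘_; id; flip)
open import Function.Bundles using (Equivalence; mk⇔)
open import Function.Properties.Inverse using (Inverse⇒Injection)
open import Induction.WellFounded using (Acc; acc)
open import Relation.Binary using (DecidableEquality; Setoid)
open import Relation.Binary.Construct.Closure.ReflexiveTransitive using (ε; _◅_)
open import Relation.Binary.PropositionalEquality using (_≡_; refl; sym; cong; cong₂; subst)
open import Relation.Nullary using (Dec; yes; no; contradiction)
open import Relation.Nullary.Decidable using (_×-dec_; map′; ¬?; via-injection; decidable-stable)

-- Lists compared as sets.

∼-sym : {A : Set} {xs ys : List A} → xs ∼[ set ] ys → ys ∼[ set ] xs
∼-sym {A} e = Setoid.sym ([ set ]-Equality A) e

∼-refl : {A : Set} {xs : List A} → xs ∼[ set ] xs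
∼-refl {A} = Setoid.refl ([ set ]-Equality A)

∼-trans : {A : Set} {xs ys zs : List A} → xs ∼[ set ] ys → ys ∼[ set ] zs → xs ∼[ set ] zs
∼-trans {A} e e′ = Setoid.trans ([ set ]-Equality A) e e′

∼-dec : {A : Set} → DecidableEquality A → (xs ys : List A) → Dec (xs ∼[ set ] ys)
∼-dec _≟_ xs ys =
  map′ (λ (f , g) {x} → mk⇔ (f {x}) (g {x}))
       (λ e → (λ {x} → Equivalence.to (e {x})) , (λ {x} → Equivalence.from (e {x})))
       (_⊆?_ _≟_ xs ys ×-dec _⊆?_ _≟_ ys xs)

map-∷ʳ-cong : {A B : Set} (f : A → B) {xs ys : List A} {z : B} → xs ∼[ set ] ys →
              (map f xs ++ [ z ]) ∼[ set ] (map f ys ++ [ z ])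
map-∷ʳ-cong f e = ++-cong (map-cong (λ _ → refl) e) ∼-refl

-- Finite lists of representatives.

sublists : {A : Set} → List A → List (List A)
sublists []       = [ [] ]
sublists (x ∷ xs) = sublists xs ++ map (x ∷_) (sublists xs)

filter∈sublists : {A : Set} {Q : A → Set} (Q? : ∀ x → Dec (Q x)) (xs : List A) →
                  filter Q? xs ∈ sublists xs
filter∈sublists Q? []       = here refl
filter∈sublists Q? (x ∷ xs) with Q? x
... | yes _ = ∈-++⁺ʳ (sublists xs) (∈-map⁺ (x ∷_) (filter∈sublists Q? xs))
... | no _  = ∈-++⁺ˡ (filter∈sublists Q? xs)

-- Finiteness up to a relation: rule parameters such as disjunctions range over an infinite type,
-- but those satisfying `OK` are represented, modulo `_~_`, by the finite list `reps`.
record Cover (A : Set) : Set₁ where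
  field
    OK    : A → Set
    _~_   : A → A → Set
    reps  : List A
    cover : ∀ {x} → OK x → ∃ λ y → y ∈ reps × x ~ y

open Cover

exactly : {A : Set} {Q : A → Set} (xs : List A) → (∀ {x} → Q x → x ∈ xs) → Cover A
exactly {Q = Q} xs Q⊆ = record
  { OK = Q; _~_ = _≡_; reps = xs; cover = λ q → _ , Q⊆ q , refl }

infixr 2 _⊗_

_⊗_ : {A B : Set} → Cover A → Cover B → Cover (A × B)
C ⊗ C′ = record
  { OK    = λ (x , y) → OK C x × OK C′ y
  ; _~_   = λ (x , y) (x′ , y′) → _~_ C x x′ × _~_ C′ y y′
  ; reps  = cartesianProduct (reps C) (reps C′)
  ; cover = λ (k , k′) → let _ , m , e = cover C k
                             _ , m′ , e′ = cover C′ k′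
                         in _ , ∈-cartesianProduct⁺ m m′ , e , e′ }

-- A list with entries in `Q` can be arbitrarily long, yet it has the same elements as the sublist
-- of `xs` that keeps exactly the entries occurring in it.
subsets : {A : Set} {Q : A → Set} → DecidableEquality A →
          (xs : List A) → (∀ {x} → Q x → x ∈ xs) → Cover (List A)
subsets {Q = Q} _≟_ xs Q⊆ = record
  { OK    = All Q
  ; _~_   = _∼[ set ]_
  ; reps  = sublists xs
  ; cover = λ {D} qs → _ , filter∈sublists (_∈? D) xs ,
      mk⇔ (λ m → ∈-filter⁺ (_∈? D) (Q⊆ (All.lookup qs m)) m)
          (λ m → proj₂ (∈-filter⁻ (_∈? D) {xs = xs} m)) }
  where open DecMembership _≟_ using (_∈?_)

-- Clauses modulo simplification.

module _ {P : Set} {n : ℕ} where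

  Lit : Set
  Lit = Literal (Symbol P n)

  Cl : Set
  Cl = Clause∧ (Symbol P n) n

  ≈-refl : {c : Cl} → c ≈ c
  ≈-refl {start⇒ _}       = start⇒ ∼-refl
  ≈-refl {true⇒ _}        = true⇒ ∼-refl
  ≈-refl {_ ⇒□[ _ ] _}    = pos-≈ ∼-refl
  ≈-refl {_ ⇒¬□[ _ ] _}   = neg-≈ ∼-refl

  ≈-sym : {c d : Cl} → c ≈ d → d ≈ c
  ≈-sym (start⇒ e) = start⇒ (∼-sym e)
  ≈-sym (true⇒ e)  = true⇒ (∼-sym e)
  ≈-sym (pos-≈ e)  = pos-≈ (∼-sym e)
  ≈-sym (neg-≈ e)  = neg-≈ (∼-sym e)

  ≈-trans : {c d e : Cl} → c ≈ d → d ≈ e → c ≈ e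
  ≈-trans (start⇒ e) (start⇒ e′) = start⇒ (∼-trans e e′)
  ≈-trans (true⇒ e)  (true⇒ e′)  = true⇒ (∼-trans e e′)
  ≈-trans (pos-≈ e)  (pos-≈ e′)  = pos-≈ (∼-trans e e′)
  ≈-trans (neg-≈ e)  (neg-≈ e′)  = neg-≈ (∼-trans e e′)

  ≈⇒literals∼ : {c d : Cl} → c ≈ d → literals id c ∼[ set ] literals id d
  ≈⇒literals∼ (start⇒ e) = e
  ≈⇒literals∼ (true⇒ e)  = e
  ≈⇒literals∼ (pos-≈ e)  = ++-cong e ∼-refl
  ≈⇒literals∼ (neg-≈ e)  = ++-cong e ∼-refl

  ∈ᶜ-resp-≈ : {c d : Cl} {U : List Cl} → c ≈ d → d ∈ᶜ U → c ∈ᶜ U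
  ∈ᶜ-resp-≈ e = Any.map (≈-trans e)

  ∈⇒∈ᶜ : {c : Cl} {U : List Cl} → c ∈ U → c ∈ᶜ U
  ∈⇒∈ᶜ = Any.map λ where refl → ≈-refl

  Over : (Lit → Set) → Cl → Set
  Over R c = All R (literals id c)

  Over-resp-≈ : {R : Lit → Set} {c d : Cl} → c ≈ d → Over R d → Over R c
  Over-resp-≈ e ks = All.tabulate λ m → All.lookup ks (Equivalence.to (≈⇒literals∼ e) m)

  Over-∈ᶜ : {R : Lit → Set} {c : Cl} {U : List Cl} → All (Over R) U → c ∈ᶜ U → Over R c
  Over-∈ᶜ ks m = let _ , d∈U , e = find m in Over-resp-≈ e (All.lookup ks d∈U)

  -- The order in which a rule instance (premises , conclusion) is replaced by
  -- one that fires whenever it does and has the same conclusion modulo _≈_.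
  record _⊑_ (ι κ : List Cl × Cl) : Set where
    constructor _,_
    field
      premises   : All (_∈ᶜ proj₁ ι) (proj₁ κ)
      conclusion : proj₂ ι ≈ proj₂ κ

  ⊑-refl : ∀ {ι} → ι ⊑ ι
  ⊑-refl = All.tabulate ∈⇒∈ᶜ , ≈-refl

  -- Rule instances and parametrised families of them.

  Instance : (List Cl → Cl → Set) → Set
  Instance X = ∃₂ X

  ends : ∀ {X} → Instance X → List Cl × Cl
  ends (Γ , c , _) = Γ , c

  record Family (X : List Cl → Cl → Set) : Set₁ where
    constructor family
    field
      {Param} : Set
      params  : Cover Param
      fires   : Param → Instance X

  members : ∀ {X} → List (Family X) → List (Instance X)
  members = concatMap λ (family C f) → map f (reps C)

  -- The instance comes from an acceptable parameter `x`, and whichever representative `y` the cover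
  -- supplies for `x`, the instance at `y` may replace it in the sense of `_⊑_`.
  data Covers {X : List Cl → Cl → Set} : (ι : List Cl × Cl) → Family X → Set₁ where
    via : ∀ {A} {C : Cover A} {f : A → Instance X} (x : A) → OK C x →
          (∀ {y} → _~_ C x y → ends (f x) ⊑ ends (f y)) →
          Covers (ends (f x)) (family C f)

  Covers⇒∈members : ∀ {X ι} {Fs : List (Family X)} → Any (Covers ι) Fs →
                    Any (λ i → ι ⊑ ends i) (members Fs)
  Covers⇒∈members = Any.concat⁺ ∘ Any.map⁺ ∘ Any.map λ where
    (via {C = C} x k f⊑) → let _ , m , e = cover C k in Any.map⁺ (lose m (f⊑ e))

  -- The positive premises of `NEC1` and `NEC3`, named so that they can be handled by recursion on
  -- the list of pairs.
  Boxes : Fin n → List (Lit × Lit) → List Cl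
  Boxes a = map λ (l′ᵢ , lᵢ) → [ l′ᵢ ] ⇒□[ a ] ~ lᵢ

  -- Each box premise demanded by `ps′` comes from a pair that also lies in `ps`, so exchanging the
  -- list of pairs for a set-equal one keeps a necessitation rule applicable.
  Boxes-cong : ∀ {a ps ps′ Γ Γ′} → ps ∼[ set ] ps′ → All (_∈ᶜ Γ) Γ′ →
               All (_∈ᶜ (Boxes a ps ++ Γ)) (Boxes a ps′ ++ Γ′)
  Boxes-cong {a} {ps} e ms = All.++⁺
    (All.map⁺ (All.tabulate λ m → Any.++⁺ˡ (∈⇒∈ᶜ (∈-map⁺ _ (Equivalence.from e m)))))
    (All.map (Any.++⁺ʳ (Boxes a ps)) ms)

  -- Properties of literals passed on from premises to conclusions.

  module Closure (R : Lit → Set)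
    (R-~ : ∀ {l} → R l → R (~ l)) (R-~⁻¹ : ∀ {l} → R (~ l) → R l) where

    R² : Lit × Lit → Set
    R² (l , l′) = R l × R l′

    Boxes⁻ : ∀ a ps {Γ} → All (Over R) (Boxes a ps ++ Γ) → All R² ps × All (Over R) Γ
    Boxes⁻ a []       ks = [] , ks
    Boxes⁻ a (_ ∷ ps) ((k ∷ k′ ∷ []) ∷ ks) =
      -- The premise contains `~ lᵢ` while the parameter of the rule is `lᵢ`; hence the inverse
      -- closure condition.
      let rs , gs = Boxes⁻ a ps ks in (k , R-~⁻¹ k′) ∷ rs , gs

    ~-All : ∀ {D} → All R D → All R (map ~_ D)
    ~-All = All.map⁺ ∘ All.map R-~

    last : ∀ D {l} → All R (D ++ [ l ]) → R l
    last D ks = All.head (All.++⁻ʳ D ks)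

    guards : ∀ {ps} → All R² ps → ∀ {l} → R l → All R (map (~_ ∘ proj₁) ps ++ [ ~ l ])
    guards rs k = All.++⁺ (All.map⁺ (All.map (R-~ ∘ proj₁) rs)) (R-~ k ∷ [])

    KRule-Over : ∀ {Γ c} → KRule Γ c → All (Over R) Γ → Over R c
    KRule-Over (IRES1 D D′ l) (k ∷ k′ ∷ []) = All.++⁺ (All.++⁻ˡ D k) (All.++⁻ˡ D′ k′)
    KRule-Over (IRES2 D D′ l) (k ∷ k′ ∷ []) = All.++⁺ (All.++⁻ˡ D k) (All.++⁻ˡ D′ k′)
    KRule-Over (LRES D D′ l)  (k ∷ k′ ∷ []) = All.++⁺ (All.++⁻ˡ D k) (All.++⁻ˡ D′ k′)
    KRule-Over (MRES a l l₁ l₂) ((k₁ ∷ _) ∷ (k₂ ∷ _) ∷ []) = R-~ k₁ ∷ R-~ k₂ ∷ []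
    KRule-Over (NEC1 a ps l′ l) ks with Boxes⁻ a ps ks
    ... | rs , (k′ ∷ _) ∷ _ = guards rs k′
    KRule-Over (NEC2 a l₁ l₂ l′₁ l′₂ l′₃) ((k₁ ∷ _) ∷ (k₂ ∷ _) ∷ (k₃ ∷ _) ∷ []) =
      R-~ k₁ ∷ R-~ k₂ ∷ R-~ k₃ ∷ []
    KRule-Over (NEC3 a ps l′ l _) ks with Boxes⁻ a ps ks
    ... | rs , (k′ ∷ _) ∷ _ = guards rs k′

    -- Apart from literals `pl (pos a l)`, conclusions contain only literals of the premises and
    -- complements of these. The hypothesis on `pos` pays for the exception; it is trivial for
    -- `PropKnown`, the property to which this is applied.
    GRule₁-Over : (∀ {a l} → R (pl (pos a l))) → ∀ {p q r s Γ c} →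
                  GRule₁ p q r s Γ c → All (Over R) Γ → Over R c
    GRule₁-Over _ (T₁ a D l) (k ∷ []) = All.++⁺ (~-All (All.++⁻ˡ D k)) (R-~ (last D k) ∷ [])
    GRule₁-Over _ (T₂ a l l′) ((k ∷ k′ ∷ []) ∷ []) = R-~ k ∷ k′ ∷ []
    GRule₁-Over _ (Ban₁ a D l) (k ∷ []) = All.++⁺ (~-All (All.++⁻ˡ D k)) (last D k ∷ [])
    GRule₁-Over _ (Ban₂ a l l′) ((k ∷ k′ ∷ []) ∷ []) = R-~ k ∷ R-~⁻¹ k′ ∷ []
    GRule₁-Over R-pos (B₁ a D l) (k ∷ []) = All.++⁺ (~-All (All.++⁻ˡ D k)) (R-pos ∷ [])
    GRule₁-Over _ (B₂ a l l′) ((k ∷ k′ ∷ []) ∷ []) = R-~ k′ ∷ R-~ k ∷ []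
    GRule₁-Over _ (D₁ a l l′) ((k ∷ k′ ∷ []) ∷ []) = k ∷ R-~ k′ ∷ []
    GRule₁-Over R-pos (0111₁ a l l′) ((k ∷ k′ ∷ []) ∷ []) = k ∷ R-pos ∷ []
    GRule₁-Over R-pos (0111₂ a l l′) ((k ∷ k′ ∷ []) ∷ []) = R-pos ∷ R-~ k′ ∷ []
    GRule₁-Over _ (F₁ a l l′) ((k ∷ k′ ∷ []) ∷ []) = k ∷ R-~⁻¹ k′ ∷ []
    GRule₁-Over R-pos (5₁ a l l′) ((k ∷ k′ ∷ []) ∷ []) = k ∷ R-pos ∷ []
    GRule₁-Over R-pos (5₂ a l l′) ((k ∷ k′ ∷ []) ∷ []) = R-pos ∷ k′ ∷ []
    GRule₁-Over R-pos (G1₁ a l l′) ((k ∷ k′ ∷ []) ∷ []) = R-pos ∷ R-pos ∷ []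

    Rule-Over : (∀ {a l} → R (pl (pos a l))) → ∀ {p q r s Γ c} →
                Rule p q r s Γ c → All (Over R) Γ → Over R c
    Rule-Over R-pos (inj₁ ρ)        = KRule-Over ρ
    Rule-Over R-pos (inj₂ (inj₁ ρ)) = GRule₁-Over R-pos ρ
    Rule-Over R-pos (inj₂ (inj₂ ρ)) = GRule₁-Over R-pos ρ

    -- Finitely many instances that represent all.

    module Instances (_≟_ : DecidableEquality Lit)
                     (ls : List Lit) (R⊆ls : ∀ {l} → R l → l ∈ ls) where

      -- The agent in `T₁`, `Ban₁` and `B₁` is not determined by the premise, so all of `Fin n` is
      -- tried.
      agent : Cover (Fin n)
      agent = exactly {Q = λ _ → ⊤} (allFin n) (λ _ → ∈-allFin _)

      literal : Cover Lit
      literal = exactly ls R⊆ls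

      disjunction : Cover (List Lit)
      disjunction = subsets _≟_ ls R⊆ls

      R²⊆ls² : ∀ {x} → R² x → x ∈ cartesianProduct ls ls
      R²⊆ls² (k , k′) = ∈-cartesianProduct⁺ (R⊆ls k) (R⊆ls k′)

      pair : Cover (Lit × Lit)
      pair = exactly (cartesianProduct ls ls) R²⊆ls²

      pairs : Cover (List (Lit × Lit))
      pairs = subsets (≡-dec _≟_ _≟_) (cartesianProduct ls ls) R²⊆ls²

      KRules : List (Family KRule)
      KRules =
          family (disjunction ⊗ disjunction ⊗ literal) (λ (D , D′ , l) → _ , _ , IRES1 D D′ l)
        ∷ family (disjunction ⊗ disjunction ⊗ literal) (λ (D , D′ , l) → _ , _ , IRES2 D D′ l)
        ∷ family (disjunction ⊗ disjunction ⊗ literal) (λ (D , D′ , l) → _ , _ , LRES D D′ l)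
        ∷ family (agent ⊗ literal ⊗ literal ⊗ literal)
                 (λ (a , l , l₁ , l₂) → _ , _ , MRES a l l₁ l₂)
        ∷ family (agent ⊗ pairs ⊗ literal ⊗ literal)
                 (λ (a , ps , l′ , l) → _ , _ , NEC1 a ps l′ l)
        ∷ family (agent ⊗ literal ⊗ literal ⊗ literal ⊗ literal ⊗ literal)
                 (λ (a , l₁ , l₂ , l′₁ , l′₂ , l′₃) → _ , _ , NEC2 a l₁ l₂ l′₁ l′₂ l′₃)
        -- `NEC3` demands at least one pair. The first one is kept apart, so that the list stays
        -- nonempty whatever represents the rest.
        ∷ family (agent ⊗ pair ⊗ pairs ⊗ literal ⊗ literal)
                 (λ (a , x , ps , l′ , l) → _ , _ , NEC3 a (x ∷ ps) l′ l (s≤s z≤n))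
        ∷ []

      -- Agents, literals and single pairs represent themselves. Disjunctions and lists of pairs
      -- change up to set equality, which is used backwards to find the new premises among the old
      -- ones and forwards to compare the conclusions.
      KRules-cover : ∀ {Γ c} → KRule Γ c → All (Over R) Γ → Any (Covers (Γ , c)) KRules
      KRules-cover (IRES1 D D′ l) (k ∷ k′ ∷ []) =
        here (via (D , D′ , l) (All.++⁻ˡ D k , All.++⁻ˡ D′ k′ , last D k) λ where
          (e , e′ , refl) →
            (here (true⇒ (++-cong (∼-sym e) ∼-refl))
              ∷ there (here (start⇒ (++-cong (∼-sym e′) ∼-refl))) ∷ []) ,
            (start⇒ (++-cong e e′)))
      KRules-cover (IRES2 D D′ l) (k ∷ k′ ∷ []) =
        there (here (via (D , D′ , l) (All.++⁻ˡ D k , All.++⁻ˡ D′ k′ , last D k) λ where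
          (e , e′ , refl) →
            (here (start⇒ (++-cong (∼-sym e) ∼-refl))
              ∷ there (here (start⇒ (++-cong (∼-sym e′) ∼-refl))) ∷ []) ,
            (start⇒ (++-cong e e′))))
      KRules-cover (LRES D D′ l) (k ∷ k′ ∷ []) =
        there (there (here (via (D , D′ , l) (All.++⁻ˡ D k , All.++⁻ˡ D′ k′ , last D k) λ where
          (e , e′ , refl) →
            (here (true⇒ (++-cong (∼-sym e) ∼-refl))
              ∷ there (here (true⇒ (++-cong (∼-sym e′) ∼-refl))) ∷ []) ,
            (true⇒ (++-cong e e′)))))
      KRules-cover (MRES a l l₁ l₂) ((k₁ ∷ k ∷ []) ∷ (k₂ ∷ _) ∷ []) =
        there (there (there (here (via (a , l , l₁ , l₂) (tt , k , k₁ , k₂) λ where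
          (refl , refl , refl , refl) → ⊑-refl))))
      KRules-cover (NEC1 a ps l′ l) ks with Boxes⁻ a ps ks
      ... | rs , (k′ ∷ k ∷ []) ∷ _ =
        there (there (there (there (here (via (a , ps , l′ , l) (tt , rs , k′ , k) λ where
          (refl , e , refl , refl) →
            Boxes-cong e (here ≈-refl
              ∷ there (here (true⇒ map-∷ʳ-cong proj₂ (∼-sym e))) ∷ []) ,
            (true⇒ map-∷ʳ-cong (~_ ∘ proj₁) e))))))
      KRules-cover (NEC2 a l₁ l₂ l′₁ l′₂ l′₃)
        ((k′₁ ∷ k₁ ∷ []) ∷ (k′₂ ∷ _) ∷ (k′₃ ∷ k₂ ∷ []) ∷ []) =
        there (there (there (there (there (here
          (via (a , l₁ , l₂ , l′₁ , l′₂ , l′₃) (tt , k₁ , k₂ , k′₁ , k′₂ , k′₃) λ where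
            (refl , refl , refl , refl , refl , refl) → ⊑-refl))))))
      KRules-cover (NEC3 a (x ∷ ps) l′ l (s≤s z≤n)) ks with Boxes⁻ a (x ∷ ps) ks
      ... | r ∷ rs , (k′ ∷ k ∷ []) ∷ _ =
        there (there (there (there (there (there (here
          (via (a , x , ps , l′ , l) (tt , r , rs , k′ , k) λ where
            (refl , refl , e , refl , refl) →
              Boxes-cong (∷-cong refl e) (here ≈-refl
                ∷ there (here (true⇒ (map-cong (λ _ → refl) (∷-cong {x = x} refl (∼-sym e))))) ∷ []) ,
              (true⇒ map-∷ʳ-cong (~_ ∘ proj₁) (∷-cong {x = x} refl e)))))))))

      GRules : ∀ p q r s → List (Family (GRule₁ p q r s))
      GRules 0F 0F 0F 1F =
          family (agent ⊗ disjunction ⊗ literal) (λ (a , D , l) → _ , _ , T₁ a D l)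
        ∷ family (agent ⊗ literal ⊗ literal) (λ (a , l , l′) → _ , _ , T₂ a l l′) ∷ []
      GRules 0F 0F 1F 0F =
          family (agent ⊗ disjunction ⊗ literal) (λ (a , D , l) → _ , _ , Ban₁ a D l)
        ∷ family (agent ⊗ literal ⊗ literal) (λ (a , l , l′) → _ , _ , Ban₂ a l l′) ∷ []
      GRules 0F 0F 1F 1F =
          family (agent ⊗ disjunction ⊗ literal) (λ (a , D , l) → _ , _ , B₁ a D l)
        ∷ family (agent ⊗ literal ⊗ literal) (λ (a , l , l′) → _ , _ , B₂ a l l′) ∷ []
      GRules 0F 1F 0F 1F =
          family (agent ⊗ literal ⊗ literal) (λ (a , l , l′) → _ , _ , D₁ a l l′) ∷ []
      GRules 0F 1F 1F 1F =
          family (agent ⊗ literal ⊗ literal) (λ (a , l , l′) → _ , _ , 0111₁ a l l′)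
        ∷ family (agent ⊗ literal ⊗ literal) (λ (a , l , l′) → _ , _ , 0111₂ a l l′) ∷ []
      GRules 1F 0F 1F 0F =
          family (agent ⊗ literal ⊗ literal) (λ (a , l , l′) → _ , _ , F₁ a l l′) ∷ []
      GRules 1F 0F 1F 1F =
          family (agent ⊗ literal ⊗ literal) (λ (a , l , l′) → _ , _ , 5₁ a l l′)
        ∷ family (agent ⊗ literal ⊗ literal) (λ (a , l , l′) → _ , _ , 5₂ a l l′) ∷ []
      GRules 1F 1F 1F 1F =
          family (agent ⊗ literal ⊗ literal) (λ (a , l , l′) → _ , _ , G1₁ a l l′) ∷ []
      -- This leaves the tautological tuples and the tuples whose mirror image is listed above;
      -- `GInstances` reaches the latter through `GRules r s p q`.
      GRules _ _ _ _ = []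

      via-literals : ∀ {X} {f : Fin n × Lit × Lit → Instance X} {a l l′} → R l → R l′ →
                     Covers (ends (f (a , l , l′))) (family (agent ⊗ literal ⊗ literal) f)
      via-literals k k′ = via _ (tt , k , k′) λ where (refl , refl , refl) → ⊑-refl

      GRules-cover : ∀ {p q r s Γ c} → GRule₁ p q r s Γ c → All (Over R) Γ →
                     Any (Covers (Γ , c)) (GRules p q r s)
      GRules-cover (T₁ a D l) (k ∷ []) =
        here (via (a , D , l) (tt , All.++⁻ˡ D k , last D k) λ where
          (refl , e , refl) →
            (here (true⇒ (++-cong (∼-sym e) ∼-refl)) ∷ []) , neg-≈ (map-cong (λ _ → refl) e))
      GRules-cover (T₂ a l l′) ((k ∷ k′ ∷ []) ∷ []) = there (here (via-literals k k′))
      GRules-cover (Ban₁ a D l) (k ∷ []) =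
        here (via (a , D , l) (tt , All.++⁻ˡ D k , last D k) λ where
          (refl , e , refl) →
            (here (true⇒ (++-cong (∼-sym e) ∼-refl)) ∷ []) , pos-≈ (map-cong (λ _ → refl) e))
      GRules-cover (Ban₂ a l l′) ((k ∷ k′ ∷ []) ∷ []) = there (here (via-literals k (R-~⁻¹ k′)))
      GRules-cover (B₁ a D l) (k ∷ []) =
        here (via (a , D , l) (tt , All.++⁻ˡ D k , last D k) λ where
          (refl , e , refl) →
            (here (true⇒ (++-cong (∼-sym e) ∼-refl)) ∷ []) , pos-≈ (map-cong (λ _ → refl) e))
      GRules-cover (B₂ a l l′) ((k ∷ k′ ∷ []) ∷ []) = there (here (via-literals k k′))
      GRules-cover (D₁ a l l′) ((k ∷ k′ ∷ []) ∷ []) = here (via-literals k k′)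
      GRules-cover (0111₁ a l l′) ((k ∷ k′ ∷ []) ∷ []) = here (via-literals k k′)
      GRules-cover (0111₂ a l l′) ((k ∷ k′ ∷ []) ∷ []) = there (here (via-literals k k′))
      GRules-cover (F₁ a l l′) ((k ∷ k′ ∷ []) ∷ []) = here (via-literals k (R-~⁻¹ k′))
      GRules-cover (5₁ a l l′) ((k ∷ k′ ∷ []) ∷ []) = here (via-literals k (R-~⁻¹ k′))
      GRules-cover (5₂ a l l′) ((k ∷ k′ ∷ []) ∷ []) = there (here (via-literals k k′))
      GRules-cover (G1₁ a l l′) ((k ∷ k′ ∷ []) ∷ []) = here (via-literals k k′)

      KInstances : ∀ p q r s → List (Instance (Rule p q r s))
      KInstances p q r s = map (λ (_ , _ , ρ) → _ , _ , inj₁ ρ) (members KRules)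

      GInstances : ∀ p q r s → List (Instance (GRule p q r s))
      GInstances p q r s =
           map (λ (_ , _ , ρ) → _ , _ , inj₁ ρ) (members (GRules p q r s))
        ++ map (λ (_ , _ , ρ) → _ , _ , inj₂ ρ) (members (GRules r s p q))

      instances : ∀ p q r s → List (Instance (Rule p q r s))
      instances p q r s =
        KInstances p q r s ++ map (λ (_ , _ , ρ) → _ , _ , inj₂ ρ) (GInstances p q r s)

      GInstances-cover : ∀ p q r s {Γ c} → GRule p q r s Γ c → All (Over R) Γ →
                         Any (λ i → (Γ , c) ⊑ ends i) (GInstances p q r s)
      GInstances-cover p q r s (inj₁ ρ) ks =
        Any.++⁺ˡ (Any.map⁺ (Covers⇒∈members (GRules-cover ρ ks)))
      GInstances-cover p q r s (inj₂ ρ) ks =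
        Any.++⁺ʳ (map _ (members (GRules p q r s)))
          (Any.map⁺ (Covers⇒∈members (GRules-cover ρ ks)))

      instances-cover : ∀ p q r s {Γ c} → Rule p q r s Γ c → All (Over R) Γ →
                        Any (λ i → (Γ , c) ⊑ ends i) (instances p q r s)
      instances-cover p q r s (inj₁ ρ) ks =
        Any.++⁺ˡ {xs = KInstances p q r s} (Any.map⁺ (Covers⇒∈members (KRules-cover ρ ks)))
      instances-cover p q r s (inj₂ ρ) ks =
        Any.++⁺ʳ (KInstances p q r s) (Any.map⁺ (GInstances-cover p q r s ρ ks))

-- Decidability of equality modulo simplification.

module Termination {P : Set} (_≟_ : DecidableEquality P) {n : ℕ}
                   (p q r s : Fin 2) (T : List (Clause P n)) where

  open Calculus p q r s T

  mutual
    _≟ˢ_ : DecidableEquality (Symbol P n)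
    prop x  ≟ˢ prop y  = map′ (cong prop) (λ where refl → refl) (x ≟ y)
    prop _  ≟ˢ pos _ _ = no λ ()
    pos _ _ ≟ˢ prop _  = no λ ()
    pos a l ≟ˢ pos b m =
      map′ (uncurry (cong₂ pos)) (λ where refl → refl , refl) ((a Fin.≟ b) ×-dec (l ≟ˡ m))

    _≟ˡ_ : DecidableEquality (Literal (Symbol P n))
    pl σ ≟ˡ pl τ = map′ (cong pl) (λ where refl → refl) (σ ≟ˢ τ)
    pl _ ≟ˡ nl _ = no λ ()
    nl _ ≟ˡ pl _ = no λ ()
    nl σ ≟ˡ nl τ = map′ (cong nl) (λ where refl → refl) (σ ≟ˢ τ)

  open DecMembership _≟ˢ_ using () renaming (_∈?_ to _∈ˢ?_)

  _≈?_ : (c d : Cl) → Dec (c ≈ d)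
  (start⇒ D)      ≈? (start⇒ D′)      = map′ start⇒_ (λ where (start⇒ e) → e) (∼-dec _≟ˡ_ D D′)
  (true⇒ D)       ≈? (true⇒ D′)       = map′ true⇒_ (λ where (true⇒ e) → e) (∼-dec _≟ˡ_ D D′)
  (C ⇒□[ a ] l) ≈? (C′ ⇒□[ b ] m) with (a Fin.≟ b) ×-dec (l ≟ˡ m)
  ... | no ≢             = no λ where (pos-≈ _) → ≢ (refl , refl)
  ... | yes (refl , refl) = map′ pos-≈ (λ where (pos-≈ e) → e) (∼-dec _≟ˡ_ C C′)
  (C ⇒¬□[ a ] l) ≈? (C′ ⇒¬□[ b ] m) with (a Fin.≟ b) ×-dec (l ≟ˡ m)
  ... | no ≢             = no λ where (neg-≈ _) → ≢ (refl , refl)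
  ... | yes (refl , refl) = map′ neg-≈ (λ where (neg-≈ e) → e) (∼-dec _≟ˡ_ C C′)
  (start⇒ _)      ≈? (true⇒ _)        = no λ ()
  (start⇒ _)      ≈? (_ ⇒□[ _ ] _)    = no λ ()
  (start⇒ _)      ≈? (_ ⇒¬□[ _ ] _)   = no λ ()
  (true⇒ _)       ≈? (start⇒ _)       = no λ ()
  (true⇒ _)       ≈? (_ ⇒□[ _ ] _)    = no λ ()
  (true⇒ _)       ≈? (_ ⇒¬□[ _ ] _)   = no λ ()
  (_ ⇒□[ _ ] _)   ≈? (start⇒ _)       = no λ ()
  (_ ⇒□[ _ ] _)   ≈? (true⇒ _)        = no λ ()
  (_ ⇒□[ _ ] _)   ≈? (_ ⇒¬□[ _ ] _)   = no λ ()
  (_ ⇒¬□[ _ ] _)  ≈? (start⇒ _)       = no λ ()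
  (_ ⇒¬□[ _ ] _)  ≈? (true⇒ _)        = no λ ()
  (_ ⇒¬□[ _ ] _)  ≈? (_ ⇒□[ _ ] _)    = no λ ()

  _∈ᶜ?_ : (c : Cl) (U : List Cl) → Dec (c ∈ᶜ U)
  c ∈ᶜ? U = Any.any? (c ≈?_) U

  -- Known symbols as an invariant of derivations.

  symbols : List P
  symbols = concatMap (map symbolOf ∘ literals [_]) T

  signature : List (Symbol P n)
  signature = map prop symbols ++ definitionSymbols T

  Known : Symbol P n → Set
  Known (prop x)  = x ∈ symbols
  Known (pos a l) = pos a l ∈ definitionSymbols T

  -- Preserved by every rule; Known then follows from admissibility.
  PropKnown : Symbol P n → Set
  PropKnown (prop x)  = x ∈ symbols
  PropKnown (pos _ _) = ⊤

  On : (Symbol P n → Set) → Lit → Set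
  On K = K ∘ symbolOf

  On-~ : ∀ {K l} → On K l → On K (~ l)
  On-~ {l = pl _} k = k
  On-~ {l = nl _} k = k

  On-~⁻¹ : ∀ {K l} → On K (~ l) → On K l
  On-~⁻¹ {l = pl _} k = k
  On-~⁻¹ {l = nl _} k = k

  Known⇒∈signature : ∀ {σ} → Known σ → σ ∈ signature
  Known⇒∈signature {prop x}  k = ∈-++⁺ˡ (∈-map⁺ prop k)
  Known⇒∈signature {pos a l} k = ∈-++⁺ʳ (map prop symbols) k

  Known⇒PropKnown : ∀ {σ} → Known σ → PropKnown σ
  Known⇒PropKnown {prop _}  k = k
  Known⇒PropKnown {pos _ _} _ = tt

  PropKnown⇒Known : ∀ {σ} → PropKnown σ →
                    (∀ a l → pos a l ≡ σ → pos a l ∈ definitionSymbols T) → Known σ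
  PropKnown⇒Known {prop _}  k _ = k
  PropKnown⇒Known {pos a l} _ d = d a l refl

  known? : ∀ σ → Dec (Known σ)
  known? (prop x)  = DecMembership._∈?_ _≟_ x symbols
  known? (pos a l) = pos a l ∈ˢ? definitionSymbols T

  knownLiterals : List Lit
  knownLiterals = map pl signature ++ map nl signature

  Known⇒∈knownLiterals : ∀ {l} → On Known l → l ∈ knownLiterals
  Known⇒∈knownLiterals {pl σ} k = ∈-++⁺ˡ (∈-map⁺ pl (Known⇒∈signature k))
  Known⇒∈knownLiterals {nl σ} k = ∈-++⁺ʳ (map pl signature) (∈-map⁺ nl (Known⇒∈signature k))

  open Closure (On Known) (λ {l} → On-~ {Known} {l}) (λ {l} → On-~⁻¹ {Known} {l})
  open Instances _≟ˡ_ knownLiterals Known⇒∈knownLiterals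
  module PropKnown = Closure (On PropKnown)
    (λ {l} → On-~ {PropKnown} {l}) (λ {l} → On-~⁻¹ {PropKnown} {l})

  -- Lets the search for a new clause test the decidable `Known` in place of `Admissible`, which
  -- quantifies over all literals.
  Known⇒Admissible : ∀ {c} → Over (On Known) c → Admissible T c
  Known⇒Admissible ks a l m with _ , l∈c , eq ← ∈-map⁻ symbolOf m =
    subst Known (sym eq) (All.lookup ks l∈c)

  Admissible⇒Known : ∀ {c} → Over (On PropKnown) c → Admissible T c → Over (On Known) c
  Admissible⇒Known {c} ks adm = All.tabulate λ m →
    PropKnown⇒Known (All.lookup ks m) λ a l eq →
      adm a l (subst (_∈ map symbolOf (literals id c)) (sym eq) (∈-map⁺ symbolOf m))

  AllKnown : List Cl → Set
  AllKnown = All (Over (On Known))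

  Derivable⇒Known : ∀ {U c} → AllKnown U → Derivable U c → Over (On Known) c
  Derivable⇒Known ks (apply {c = c} ρ ms adm) =
    Admissible⇒Known {c}
      (PropKnown.Rule-Over (λ {a} {l} → tt) ρ
        (All.map (All.map (λ {l} → Known⇒PropKnown {symbolOf l}) ∘ Over-∈ᶜ ks) ms))
      adm

  Step-Known : ∀ {U V} → AllKnown U → Step U V → AllKnown V
  Step-Known ks (add d _) = Derivable⇒Known ks d ∷ ks

  Star-Known : ∀ {U V} → AllKnown U → Star Step U V → AllKnown V
  Star-Known ks ε        = ks
  Star-Known ks (t ◅ ts) = Star-Known (Step-Known ks t) ts

  -- Termination of steps and decision of saturation.

  candidates : List (Instance (Rule p q r s))
  candidates = instances p q r s

  conclusions : List Cl
  conclusions = map (proj₁ ∘ proj₂) candidates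

  -- The premises lie in `U` modulo `≈` and are therefore known, so the instance has a
  -- representative, and its premises are in turn found in `U`.
  Derivable⇒candidate : ∀ {U c} → AllKnown U → Derivable U c →
    Any (λ (Γ , d , _) → All (_∈ᶜ U) Γ × c ≈ d) candidates
  Derivable⇒candidate ks (apply ρ ms _) =
    Any.map (λ (ms′ , e) → All.map (transfer ms) ms′ , e)
            (instances-cover p q r s ρ (All.map (Over-∈ᶜ ks) ms))
    where
    transfer : ∀ {U Γ d} → All (_∈ᶜ U) Γ → d ∈ᶜ Γ → d ∈ᶜ U
    transfer ms m = let _ , e∈Γ , d≈e = find m in ∈ᶜ-resp-≈ d≈e (All.lookup ms e∈Γ)

  -- `Q` holds, modulo `≈`, the conclusions still missing from `U`; its length is the termination
  -- measure.
  Pending : List Cl → List Cl → Set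
  Pending Q U = ∀ {c} → c ∈ᶜ conclusions → c ∉ᶜ U → c ∈ᶜ Q

  -- A newly added clause matches some candidate conclusion and is missing from `U`, so it occurs in
  -- `Q`. Deleting everything equivalent to it makes `Q` strictly shorter.
  Step-acc : ∀ {U Q} → Acc _<_ (length Q) → AllKnown U → Pending Q U → Acc (flip Step) U
  Step-acc {U} {Q} (acc rec) ks pend = acc λ where
    (add {c} d c∉U) →
      let c≉? = λ e → ¬? (c ≈? e)
          Q′  = filter c≉? Q
          c∈Q = pend (Any.map⁺ (Any.map proj₂ (Derivable⇒candidate ks d))) c∉U
          pend′ : Pending Q′ (c ∷ U)
          pend′ m c′∉ =
            let e , e∈Q , c′≈e = find (pend m (c′∉ ∘ there))
            -- The entry `e` survives the filter: otherwise `c′` would be equivalent to `c`, which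
            -- has just been added.
            in lose (∈-filter⁺ c≉? e∈Q λ c≈e → c′∉ (here (≈-trans c′≈e (≈-sym c≈e)))) c′≈e
      in Step-acc (rec (filter-notAll c≉? Q (Any.map contradiction c∈Q)))
                  (Derivable⇒Known ks d ∷ ks) pend′

  Known⇒acc : ∀ {U} → AllKnown U → Acc (flip Step) U
  Known⇒acc ks = Step-acc {Q = conclusions} (<-wellFounded _) ks (λ m _ → m)

  -- A search through the finite list `candidates` is enough: a derivable clause missing from `U`
  -- yields a candidate with premises in `U` and an equivalent conclusion, which is then known and
  -- missing as well.
  progress : ∀ {U} → AllKnown U → (∃ (Step U)) ⊎ Saturated U
  progress {U} ks with Any.any? fires? candidates
    where
    fires? : (i : Instance (Rule p q r s)) → let Γ , c , _ = i in
             Dec (All (_∈ᶜ U) Γ × Over (On Known) c × c ∉ᶜ U)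
    fires? (Γ , c , _) = All.all? (_∈ᶜ? U) Γ
      ×-dec (All.all? (known? ∘ symbolOf) (literals id c) ×-dec ¬? (c ∈ᶜ? U))
  ... | yes some = let (_ , c , ρ) , _ , ms , k , c∉U = find some in
    inj₁ (_ , add (apply ρ ms (Known⇒Admissible {c} k)) c∉U)
  ... | no none = inj₂ λ c d → decidable-stable (c ∈ᶜ? U) λ c∉U →
    none (Any.map (λ (ms , c≈d) →
      ms , Over-resp-≈ (≈-sym c≈d) (Derivable⇒Known ks d) , c∉U ∘ ∈ᶜ-resp-≈ c≈d)
      (Derivable⇒candidate ks d))

  saturate : ∀ {U} → Acc (flip Step) U → AllKnown U → ∃ λ V → Star Step U V × Saturated V
  saturate {U} (acc rec) ks with progress ks
  ... | inj₂ sat     = U , ε , sat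
  ... | inj₁ (V , t) = let W , ts , sat = saturate (rec t) (Step-Known ks t) in W , t ◅ ts , sat

  -- The last stage of a derivation.

  ends-after : (d : Derivation) → ∀ {U} → Acc (flip Step) U → ∀ i → stage d i ≡ just U →
               ∃₂ λ k V → stage d k ≡ just V × stage d (suc k) ≡ nothing
  ends-after d (acc rec) i eq
    -- Transporting `next d i` along `eq` makes its source `just U`, which excludes `stopped`;
    -- abstracting the next stage at the same time lets the match decide between `step` and `stop`.
    with stage d (suc i) in eq′ | subst (λ M → Next M (stage d (suc i))) eq (next d i)
  ... | just V  | step t = ends-after d (rec t) (suc i) eq′
  ... | nothing | stop   = i , _ , eq , eq′

  -- The initial clauses are over known symbols.

  mapLiteral-Known : ∀ l → symbolOf l ∈ symbols → On Known (mapLiteral prop l)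
  mapLiteral-Known (pl _) m = m
  mapLiteral-Known (nl _) m = m

  embed-Known : ∀ c → (∀ {x} → x ∈ map symbolOf (literals [_] c) → x ∈ symbols) →
                Over (On Known) (embed c)
  embed-Known (start⇒ D) h =
    All.map⁺ (All.tabulate λ {l} m → mapLiteral-Known l (h (∈-map⁺ symbolOf m)))
  embed-Known (true⇒ D) h =
    All.map⁺ (All.tabulate λ {l} m → mapLiteral-Known l (h (∈-map⁺ symbolOf m)))
  embed-Known (l′ ⇒□[ _ ] l) h =
    mapLiteral-Known l′ (h (here refl)) ∷ mapLiteral-Known l (h (there (here refl))) ∷ []
  embed-Known (l′ ⇒¬□[ _ ] l) h =
    mapLiteral-Known l′ (h (here refl)) ∷ mapLiteral-Known l (h (there (here refl))) ∷ []

  ∈ℒ⇒∈symbols : ∀ {l} → l ∈ ℒ {n = n} T → symbolOf l ∈ symbols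
  ∈ℒ⇒∈symbols m with find (∈-concatMap⁻ _ {xs = symbols} m)
  ... | _ , x∈ , here refl         = x∈
  ... | _ , x∈ , there (here refl) = x∈

  pos∈definitionSymbols : ∀ {a l} → a ∈ agents T → l ∈ ℒ {n = n} T →
                          pos a (mapLiteral prop l) ∈ definitionSymbols T
  pos∈definitionSymbols {a} {l} a∈ l∈ =
    ∈-concatMap⁺ (λ b → concatMap (λ m → [ pos b (mapLiteral prop m) ]) (ℒ T))
      (lose a∈ (∈-concatMap⁺ (λ m → [ pos a (mapLiteral prop m) ]) (lose l∈ (here refl))))

  definitionClauses-Known : AllKnown (definitionClauses T)
  definitionClauses-Known =
    All.concat⁺ (All.map⁺ (All.tabulate λ a∈ →
      All.concat⁺ (All.map⁺ (All.tabulate λ {l} l∈ →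
        let ~l-Known = On-~ {Known} {mapLiteral prop l} (mapLiteral-Known l (∈ℒ⇒∈symbols l∈))
        in (pos∈definitionSymbols a∈ l∈ ∷ ~l-Known ∷ [])
           ∷ (pos∈definitionSymbols a∈ l∈ ∷ ~l-Known ∷ []) ∷ []))))

  initial-Known : AllKnown (initialSet T)
  initial-Known = All.++⁺ {xs = map embed T}
    (All.map⁺ (All.tabulate λ {c} c∈T →
      embed-Known c λ x∈c → ∈-concatMap⁺ (map symbolOf ∘ literals [_]) (lose c∈T x∈c)))
    definitionClauses-Known

-- Finiteness of derivations and extension to terminated sets.

theorem3 : ∀ (P : Set) → P ↔ ℕ →
    ∀ (n : ℕ) → n ≥ 1 → ∀ (p q r s : Fin 2) (T : List (Clause P n)) →
    let open Calculus p q r s T in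
    (∀ (d : Derivation) → Finite d)
    × (∀ (d : Derivation) → Exhaustive d → Terminates d)
    × (∀ U → Star Step (initialSet T) U →
    ∃ λ V → Star Step U V × Terminated V)
theorem3 P P↔ℕ n _ p q r s T =
  -- `k` is the index of the last clause set, so the sequence is over at `suc k`.
  (λ d → let k , _ , _ , eq = last-stage d in suc k , eq) ,
  (λ d ex → let k , V , eq , eq′ = last-stage d in k , V , eq , ex k V eq eq′) ,
  -- Saturation is continued past any contradiction, so the second alternative of `Terminated` is
  -- always reached.
  (λ U ts → let ks = Star-Known initial-Known ts
                V , ts′ , sat = saturate (Known⇒acc ks) ks
            in V , ts′ , inj₂ sat)
  where
  open Calculus p q r s T
  -- Denumerability provides decidable equality of propositional symbols, pulled back from the
  -- natural numbers.
  open Termination (via-injection (Inverse⇒Injection P↔ℕ) ℕ._≟_) p q r s T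
  last-stage : (d : Derivation) → ∃₂ λ k V → stage d k ≡ just V × stage d (suc k) ≡ nothing
  last-stage d = ends-after d (Known⇒acc initial-Known) 0 (first d)
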